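{- Every sink-free split digraph $D$ admits a quasi-kernel of size at most $\frac{2}{3}|V(D)|$.
   Context: Digraphs are finite and loopless; at most one arc $(u,v)$ exists for each ordered pair of distinct vertices, but both arcs $(u,v)$ and $(v,u)$ may be present. A sink is a vertex with no outneighbor; a digraph is sink-free if it has no sink. A set of vertices is independent if there is no arc between any two of its vertices. A quasi-kernel of a digraph $D$ is an independent set $Q\subseteq V(D)$ such that from every vertex of $D$ there is a directed path of length at most two to some vertex of $Q$ (length zero for vertices of $Q$). A split graph is an undirected graph whose vertex set can be partitioned into a clique and an independent set. A split digraph is a digraph whose underlying undirected graph is a split graph. -}

module Defs where

open import Level using (0ℓ)
open import Data.Nat using (ℕ; zero; suc; _≤_)
open import Data.Fin using (Fin)
open import Data.Fin.Subset using (Subset; _∈_; _∪_; _∩_; ⊤; ⊥)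
open import Data.List using (List; []; _∷_)
open import Data.List.Relation.Unary.Unique.Propositional using (Unique)
open import Data.Product using (Σ-syntax; ∃-syntax; _×_; _,_)
open import Data.Sum using (_⊎_; inj₁; inj₂; swap)
open import Relation.Nullary using (¬_)
open import Relation.Nullary.Decidable using (_⊎-dec_)
open import Relation.Binary.Core using (Rel)
open import Relation.Binary.Definitions using (Decidable; Irreflexive; Symmetric)
open import Relation.Binary.PropositionalEquality using (_≡_; _≢_)

-- The arc set is given as a decidable relation, so there is at most one arc
-- per ordered pair, while (u , v) and (v , u) may both be arcs.
record Digraph (n : ℕ) : Set₁ where
  infix 4 _⟶_
  field
    _⟶_    : Rel (Fin n) 0ℓ
    _⟶?_   : Decidable _⟶_
    irrefl : Irreflexive _≡_ _⟶_

record Graph (n : ℕ) : Set₁ where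
  infix 4 _~_
  field
    _~_    : Rel (Fin n) 0ℓ
    _~?_   : Decidable _~_
    sym    : Symmetric _~_
    irrefl : Irreflexive _≡_ _~_

module _ {n : ℕ} (G : Graph n) where
  open Graph G

  IsClique : Subset n → Set
  IsClique K = ∀ {u v} → u ∈ K → v ∈ K → u ≢ v → u ~ v

  IsIndependentSet : Subset n → Set
  IsIndependentSet I = ∀ {u v} → u ∈ I → v ∈ I → ¬ (u ~ v)

  -- Either part of the partition may be empty.
  IsSplitGraph : Set
  IsSplitGraph = ∃[ K ] ∃[ I ]
    (K ∪ I ≡ ⊤) × (K ∩ I ≡ ⊥) × IsClique K × IsIndependentSet I

module _ {n : ℕ} (D : Digraph n) where
  open Digraph D

  underlying : Graph n
  underlying = record
    { _~_    = λ u v → (u ⟶ v) ⊎ (v ⟶ u)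
    ; _~?_   = λ u v → (u ⟶? v) ⊎-dec (v ⟶? u)
    ; sym    = swap
    ; irrefl = λ { _≡_.refl (inj₁ a) → irrefl _≡_.refl a
                 ; _≡_.refl (inj₂ a) → irrefl _≡_.refl a }
    }

  IsSplitDigraph : Set
  IsSplitDigraph = IsSplitGraph underlying

  IsSink : Fin n → Set
  IsSink u = ¬ (∃[ v ] u ⟶ v)

  SinkFree : Set
  SinkFree = ¬ (∃[ u ] IsSink u)

  data Walk : ℕ → Fin n → Fin n → Set where
    stop : ∀ {u} → Walk zero u u
    step : ∀ {ℓ u v w} → u ⟶ v → Walk ℓ v w → Walk (suc ℓ) u w

  vertices : ∀ {ℓ u v} → Walk ℓ u v → List (Fin n)
  vertices {u = u} stop       = u ∷ []
  vertices {u = u} (step _ p) = u ∷ vertices p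

  Path : ℕ → Fin n → Fin n → Set
  Path ℓ u v = Σ[ p ∈ Walk ℓ u v ] Unique (vertices p)

  IsIndependent : Subset n → Set
  IsIndependent Q = ∀ {u v} → u ∈ Q → v ∈ Q → ¬ (u ⟶ v)

  IsQuasiKernel : Subset n → Set
  IsQuasiKernel Q = IsIndependent Q ×
    (∀ u → ∃[ v ] (v ∈ Q) × (∃[ ℓ ] (ℓ ≤ 2) × Path ℓ u v))

{-# OPTIONS --safe #-}

-- Let K be the clique and I the independent part. Let K₁ be the vertices of K
-- with an outneighbour in I, choose one such outneighbour for each of them, and
-- let J be the set of the chosen vertices; let K₀ = K ∖ K₁, and let C be the set
-- of the vertices of I ∖ J without an arc into K₁. Whenever v ∈ K₀ and S ⊆ I, the
-- set v * S = {v} ∪ (S ∖ N⁻(v)) is independent, as v has no outneighbour in I.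
--
-- Every vertex of C has an outneighbour in K₀. By averaging over C and then
-- moving to a king, some king v of K₀ is reached within two steps by at least
-- half of C; call that half H. Then Q₁ = v * (I ∖ H) is a quasi-kernel with
-- |Q₁| ≤ 1 + |I| - |C| / 2. A second quasi-kernel Q₂ has at most
-- 1 + |K₁| + |C| vertices: J ∪ C if every vertex of K₀ has an arc into K₁, and
-- otherwise w * (J ∪ C), where w is a king of the set of those vertices of K₀
-- that receive arcs from all of K₁ and send none back.
-- Hence |Q₂| + 2 |Q₁| ≤ 3 + |K₁| + 2 |I| ≤ 2n as soon as K₀ ≠ ∅. If K₀ = ∅, then
-- C = ∅, and J is a quasi-kernel with |J| ≤ |K| and |J| ≤ |I|.

module Submission where

open import Defs
import Algebra.Properties.CommutativeMonoid.Sum as Sum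
open import Data.Bool using (true; false; if_then_else_)
open import Data.Fin using (Fin; zero; suc; _≟_)
open import Data.Fin.Properties using (any?)
open import Data.Fin.Subset using (∣_∣; Subset; _∈_; _∉_; _⊆_; _∪_; _∩_; ∁; _⊂_; _⊃_; ⊤; ⊥; ⁅_⁆; Nonempty)
open import Data.Fin.Subset.Induction using (⊃-wellFounded)
open import Data.Fin.Subset.Properties
open import Data.List.Relation.Unary.All using ([]; _∷_)
open import Data.List.Relation.Unary.AllPairs using ([]; _∷_)
open import Data.Nat using (ℕ; zero; suc; _+_; _*_; _≤_; _<_; z≤n; s≤s; _≤?_)
open import Data.Nat.Properties hiding (_≟_)
open import Data.Nat.Solver using (module +-*-Solver)
open import Data.Product using (∃-syntax; _×_; _,_; proj₁; proj₂)
open import Data.Sum using (_⊎_; inj₁; inj₂; [_,_]′)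
open import Data.Vec using ([]; _∷_; tabulate; here; there)
open import Data.Vec.Properties using (lookup∘tabulate; []=⇒lookup; lookup⇒[]=)
open import Function using (_∘_)
open import Induction.WellFounded using (Acc; acc)
open import Level using (0ℓ)
open import Relation.Binary.Core using (Rel)
open import Relation.Binary.Definitions using () renaming (Decidable to Decidable₂)
open import Relation.Binary.PropositionalEquality using (_≡_; _≢_; refl; sym; trans; cong; subst)
open import Relation.Nullary using (¬_; Dec; yes; no; does; contradiction)
open import Relation.Nullary.Decidable using (¬?; _×-dec_; _⊎-dec_; dec-true; decidable-stable)
open import Relation.Unary using (Pred; Decidable)

open Sum +-0-commutativeMonoid using (sum; sum-syntax; ∑-comm; sum-cong-≗)

private
  variable
    m n : ℕ

-- Finite subsets: comprehension, cardinality and images.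

does-true⇒ : {A : Set} (a? : Dec A) → does a? ≡ true → A
does-true⇒ (yes a) _ = a

abstract

  subset : {P : Pred (Fin n) 0ℓ} → Decidable P → Subset n
  subset P? = tabulate (does ∘ P?)

  ∈-subset⁺ : {P : Pred (Fin n) 0ℓ} (P? : Decidable P) → ∀ {x} → P x → x ∈ subset P?
  ∈-subset⁺ P? {x} px = lookup⇒[]= x _ (trans (lookup∘tabulate (does ∘ P?) x) (dec-true (P? x) px))

  ∈-subset⁻ : {P : Pred (Fin n) 0ℓ} (P? : Decidable P) → ∀ {x} → x ∈ subset P? → P x
  ∈-subset⁻ P? {x} x∈ = does-true⇒ (P? x) (trans (sym (lookup∘tabulate (does ∘ P?) x)) ([]=⇒lookup x∈))

  ∣subset∣≡∑ : {P : Pred (Fin n) 0ℓ} (P? : Decidable P) →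
               ∣ subset P? ∣ ≡ ∑[ x < n ] (if does (P? x) then 1 else 0)
  ∣subset∣≡∑ {zero}  P? = refl
  ∣subset∣≡∑ {suc n} P? with does (P? zero)
  ... | true  = cong suc (∣subset∣≡∑ (P? ∘ suc))
  ... | false = ∣subset∣≡∑ (P? ∘ suc)

∣p∪q∣+∣p∩q∣≡∣p∣+∣q∣ : (p q : Subset n) → ∣ p ∪ q ∣ + ∣ p ∩ q ∣ ≡ ∣ p ∣ + ∣ q ∣
∣p∪q∣+∣p∩q∣≡∣p∣+∣q∣ []          []          = refl
∣p∪q∣+∣p∩q∣≡∣p∣+∣q∣ (true  ∷ p) (true  ∷ q) = cong suc (trans (+-suc _ _)
  (trans (cong suc (∣p∪q∣+∣p∩q∣≡∣p∣+∣q∣ p q)) (sym (+-suc _ _))))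
∣p∪q∣+∣p∩q∣≡∣p∣+∣q∣ (true  ∷ p) (false ∷ q) = cong suc (∣p∪q∣+∣p∩q∣≡∣p∣+∣q∣ p q)
∣p∪q∣+∣p∩q∣≡∣p∣+∣q∣ (false ∷ p) (true  ∷ q) =
  trans (cong suc (∣p∪q∣+∣p∩q∣≡∣p∣+∣q∣ p q)) (sym (+-suc _ _))
∣p∪q∣+∣p∩q∣≡∣p∣+∣q∣ (false ∷ p) (false ∷ q) = ∣p∪q∣+∣p∩q∣≡∣p∣+∣q∣ p q

∣p∪q∣≤∣p∣+∣q∣ : (p q : Subset n) → ∣ p ∪ q ∣ ≤ ∣ p ∣ + ∣ q ∣
∣p∪q∣≤∣p∣+∣q∣ p q = ≤-trans (m≤m+n _ _) (≤-reflexive (∣p∪q∣+∣p∩q∣≡∣p∣+∣q∣ p q))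

disjoint⇒∣p∪q∣≡∣p∣+∣q∣ : (p q : Subset n) → p ∩ q ≡ ⊥ → ∣ p ∪ q ∣ ≡ ∣ p ∣ + ∣ q ∣
disjoint⇒∣p∪q∣≡∣p∣+∣q∣ {n} p q p∩q≡⊥ = trans (sym (+-identityʳ _))
  (trans (cong (∣ p ∪ q ∣ +_) (sym (trans (cong ∣_∣ p∩q≡⊥) (∣⊥∣≡0 n)))) (∣p∪q∣+∣p∩q∣≡∣p∣+∣q∣ p q))

q⊆p⇒∣p∩∁q∣+∣q∣≤∣p∣ : (p q : Subset n) → q ⊆ p → ∣ p ∩ ∁ q ∣ + ∣ q ∣ ≤ ∣ p ∣
q⊆p⇒∣p∩∁q∣+∣q∣≤∣p∣ p q q⊆p = begin
  ∣ p ∩ ∁ q ∣ + ∣ q ∣ ≡⟨ disjoint⇒∣p∪q∣≡∣p∣+∣q∣ (p ∩ ∁ q) q p∩∁q∩q≡⊥ ⟨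
  ∣ (p ∩ ∁ q) ∪ q ∣   ≤⟨ p⊆q⇒∣p∣≤∣q∣ ([ p∩q⊆p p (∁ q) , q⊆p ]′ ∘ x∈p∪q⁻ (p ∩ ∁ q) q) ⟩
  ∣ p ∣               ∎
  where
  open ≤-Reasoning
  p∩∁q∩q≡⊥ : (p ∩ ∁ q) ∩ q ≡ ⊥
  p∩∁q∩q≡⊥ = Empty-unique λ (x , x∈) →
    let (x∈p∩∁q , x∈q) = x∈p∩q⁻ (p ∩ ∁ q) q x∈ in x∈∁p⇒x∉p (p∩q⊆q p (∁ q) x∈p∩∁q) x∈q

abstract

  image : (Fin m → Fin n) → Subset m → Subset n
  image f []          = ⊥
  image f (true  ∷ p) = ⁅ f zero ⁆ ∪ image (f ∘ suc) p
  image f (false ∷ p) = image (f ∘ suc) p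

  ∈-image⁺ : (f : Fin m → Fin n) (p : Subset m) → ∀ {x} → x ∈ p → f x ∈ image f p
  ∈-image⁺ f (true  ∷ p) here        = x∈p∪q⁺ (inj₁ (x∈⁅x⁆ _))
  ∈-image⁺ f (true  ∷ p) (there x∈p) = x∈p∪q⁺ (inj₂ (∈-image⁺ (f ∘ suc) p x∈p))
  ∈-image⁺ f (false ∷ p) (there x∈p) = ∈-image⁺ (f ∘ suc) p x∈p

  ∈-image⁻ : (f : Fin m → Fin n) (p : Subset m) → ∀ {y} → y ∈ image f p → ∃[ x ] x ∈ p × y ≡ f x
  ∈-image⁻ f []          y∈ = contradiction y∈ ∉⊥
  ∈-image⁻ f (false ∷ p) y∈ with ∈-image⁻ (f ∘ suc) p y∈
  ... | x , x∈p , y≡ = suc x , there x∈p , y≡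
  ∈-image⁻ f (true  ∷ p) y∈ with x∈p∪q⁻ ⁅ f zero ⁆ _ y∈
  ... | inj₁ y∈⁅⁆ = zero , here , x∈⁅y⁆⇒x≡y _ y∈⁅⁆
  ... | inj₂ y∈im with ∈-image⁻ (f ∘ suc) p y∈im
  ... | x , x∈p , y≡ = suc x , there x∈p , y≡

  ∣image∣≤ : (f : Fin m → Fin n) (p : Subset m) → ∣ image f p ∣ ≤ ∣ p ∣
  ∣image∣≤ {n = n} f [] = ≤-reflexive (∣⊥∣≡0 n)
  ∣image∣≤ f (false ∷ p) = ∣image∣≤ (f ∘ suc) p
  ∣image∣≤ f (true  ∷ p) = ≤-trans (∣p∪q∣≤∣p∣+∣q∣ ⁅ f zero ⁆ _)
    (+-mono-≤ (≤-reflexive (∣⁅x⁆∣≡1 (f zero))) (∣image∣≤ (f ∘ suc) p))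

-- Double counting the pairs of a relation.

sum-mono-≤ : (f g : Fin n → ℕ) → (∀ x → f x ≤ g x) → sum f ≤ sum g
sum-mono-≤ {zero}  f g f≤g = z≤n
sum-mono-≤ {suc n} f g f≤g = +-mono-≤ (f≤g zero) (sum-mono-≤ (f ∘ suc) (g ∘ suc) (f≤g ∘ suc))

sum-mono-< : (f g : Fin n → ℕ) → (∀ x → f x ≤ g x) → ∀ x → f x < g x → sum f < sum g
sum-mono-< f g f≤g zero    fx<gx = +-mono-<-≤ fx<gx (sum-mono-≤ (f ∘ suc) (g ∘ suc) (f≤g ∘ suc))
sum-mono-< f g f≤g (suc x) fx<gx = +-mono-≤-< (f≤g zero) (sum-mono-< (f ∘ suc) (g ∘ suc) (f≤g ∘ suc) x fx<gx)

module _ {T : Rel (Fin n) 0ℓ} (T? : Decidable₂ T) where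

  successors predecessors : Fin n → Subset n
  successors   x = subset (λ y → T? x y)
  predecessors y = subset (λ x → T? x y)

  ∑predecessors≡∑successors : ∑[ x < n ] ∣ predecessors x ∣ ≡ ∑[ x < n ] ∣ successors x ∣
  ∑predecessors≡∑successors = trans (sum-cong-≗ (λ y → ∣subset∣≡∑ (λ x → T? x y)))
    (trans (∑-comm {n} {n} (λ y x → if does (T? x y) then 1 else 0)) (sym (sum-cong-≗ (λ x → ∣subset∣≡∑ (T? x)))))

  -- Otherwise every vertex of `p` has fewer predecessors than successors. A vertex outside `p` has
  -- no predecessor, since `T` only points into `p`. Summing over all vertices, strictly at `x₀`,
  -- contradicts that both sums count the pairs of `T`.
  ∃∣successors∣≤∣predecessors∣ : {p : Subset n} → (∀ {x y} → T x y → y ∈ p) → Nonempty p →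
                                 ∃[ x ] x ∈ p × ∣ successors x ∣ ≤ ∣ predecessors x ∣
  ∃∣successors∣≤∣predecessors∣ {p} T⇒∈p (x₀ , x₀∈p)
    with any? (λ x → (x ∈? p) ×-dec (∣ successors x ∣ ≤? ∣ predecessors x ∣))
  ... | yes found = found
  ... | no  none  = contradiction ∑predecessors≡∑successors (<⇒≢
      (sum-mono-< (∣_∣ ∘ predecessors) (∣_∣ ∘ successors) pred≤succ x₀ (pred<succ x₀∈p)))
    where
    pred<succ : ∀ {x} → x ∈ p → ∣ predecessors x ∣ < ∣ successors x ∣
    pred<succ x∈p = ≰⇒> (λ le → none (_ , x∈p , le))
    pred≤succ : ∀ x → ∣ predecessors x ∣ ≤ ∣ successors x ∣
    pred≤succ x with x ∈? p
    ... | yes x∈p = <⇒≤ (pred<succ x∈p)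
    ... | no  x∉p = p⊆q⇒∣p∣≤∣q∣ {p = predecessors x} {successors x} (λ z∈ →
      contradiction (T⇒∈p (∈-subset⁻ (λ z → T? z x) z∈)) x∉p)

-- Reachability within two steps, and kings of cliques.

module _ (D : Digraph n) where
  open Digraph D

  Reach₁ Reach₂ : Rel (Fin n) 0ℓ
  Reach₁ u v = u ≡ v ⊎ u ⟶ v
  Reach₂ u v = Reach₁ u v ⊎ ∃[ w ] u ⟶ w × w ⟶ v

  abstract
    reach₁? : Decidable₂ Reach₁
    reach₁? u v = (u ≟ v) ⊎-dec (u ⟶? v)

    reach₂? : Decidable₂ Reach₂
    reach₂? u v = reach₁? u v ⊎-dec any? (λ w → (u ⟶? w) ×-dec (w ⟶? v))

  arc-reach₁ : ∀ {u v w} → u ⟶ v → Reach₁ v w → Reach₂ u w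
  arc-reach₁ u→v (inj₁ refl) = inj₁ (inj₂ u→v)
  arc-reach₁ u→v (inj₂ v→w)  = inj₂ (_ , u→v , v→w)

  ⟶⇒≢ : ∀ {u v} → u ⟶ v → u ≢ v
  ⟶⇒≢ u→v u≡v = irrefl u≡v u→v

  reach₂⇒path : ∀ {u v} → Reach₂ u v → ∃[ ℓ ] ℓ ≤ 2 × Path D ℓ u v
  reach₂⇒path (inj₁ (inj₁ refl)) = 0 , z≤n , stop , [] ∷ []
  reach₂⇒path (inj₁ (inj₂ u→v))  = 1 , s≤s z≤n , step u→v stop , (⟶⇒≢ u→v ∷ []) ∷ [] ∷ []
  -- A two-step walk back to its start repeats a vertex; the path of length zero replaces it.
  reach₂⇒path {u} {v} (inj₂ (w , u→w , w→v)) with u ≟ v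
  ... | yes refl = 0 , z≤n , stop , [] ∷ []
  ... | no  u≢v = 2 , ≤-refl , step u→w (step w→v stop) ,
                  (⟶⇒≢ u→w ∷ u≢v ∷ []) ∷ (⟶⇒≢ w→v ∷ []) ∷ [] ∷ []

  absorbing⇒quasiKernel : ∀ {Q} → IsIndependent D Q → (∀ u → ∃[ v ] v ∈ Q × Reach₂ u v) → IsQuasiKernel D Q
  absorbing⇒quasiKernel independent absorbs = independent ,
    λ u → let (v , v∈Q , r) = absorbs u in v , v∈Q , reach₂⇒path r

  module _ {p : Subset n} (clique : IsClique (underlying D) p) where

    IsKing : Fin n → Set
    IsKing u = u ∈ p × (∀ {w} → w ∈ p → Reach₂ w u)

    -- If `w` does not reach `v` within two steps, it has no arc to `v` or to an inneighbour of `v`.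
    -- As all of these are adjacent to `w` in the clique, the arcs run towards `w`.
    unreached⇒N⁻⊆ : ∀ {v w} → v ∈ p → w ∈ p → ¬ Reach₂ w v → ∀ {z} → z ∈ p → Reach₁ z v → Reach₁ z w
    unreached⇒N⁻⊆ v∈p w∈p ¬r z∈p (inj₁ refl) with clique v∈p w∈p (λ { refl → ¬r (inj₁ (inj₁ refl)) })
    ... | inj₁ v→w = inj₂ v→w
    ... | inj₂ w→v = contradiction (inj₁ (inj₂ w→v)) ¬r
    unreached⇒N⁻⊆ v∈p w∈p ¬r z∈p (inj₂ z→v) with clique z∈p w∈p (λ { refl → ¬r (inj₁ (inj₂ z→v)) })
    ... | inj₁ z→w = inj₂ z→w
    ... | inj₂ w→z = contradiction (inj₂ (_ , w→z , z→v)) ¬r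

    -- While some `w` fails to reach `v` within two steps, move from `v` to `w`. The closed
    -- in-neighbourhood within `p` then strictly grows, so the ascent ends, and it ends at a king.
    -- The growth also gives the last component, which later keeps `half` from shrinking.
    ∃king : ∀ {v} → v ∈ p → ∃[ u ] IsKing u × (∀ {z} → z ∈ p → Reach₁ z v → Reach₁ z u)
    ∃king v∈p = climb v∈p (⊃-wellFounded _)
      where
      N⁻? : ∀ v → Decidable (λ z → z ∈ p × Reach₁ z v)
      N⁻? v z = (z ∈? p) ×-dec reach₁? z v

      climb : ∀ {v} → v ∈ p → Acc _⊃_ (subset (N⁻? v)) →
              ∃[ u ] IsKing u × (∀ {z} → z ∈ p → Reach₁ z v → Reach₁ z u)
      climb {v} v∈p (acc rec) with any? (λ w → (w ∈? p) ×-dec ¬? (reach₂? w v))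
      ... | no  none = v , (v∈p , λ {w} w∈p → decidable-stable (reach₂? w v) (λ ¬r → none (w , w∈p , ¬r))) ,
                       λ _ r → r
      ... | yes (w , w∈p , ¬r) =
        let (u , king , N⁻w⊆N⁻u) = climb w∈p (rec N⁻v⊂N⁻w)
        in u , king , λ z∈p r → N⁻w⊆N⁻u z∈p (N⁻v⊆N⁻w z∈p r)
        where
        N⁻v⊆N⁻w : ∀ {z} → z ∈ p → Reach₁ z v → Reach₁ z w
        N⁻v⊆N⁻w = unreached⇒N⁻⊆ v∈p w∈p ¬r
        N⁻v⊂N⁻w : subset (N⁻? v) ⊂ subset (N⁻? w)
        N⁻v⊂N⁻w =
          (λ z∈ → let (z∈p , r) = ∈-subset⁻ (N⁻? v) z∈ in ∈-subset⁺ (N⁻? w) (z∈p , N⁻v⊆N⁻w z∈p r)) ,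
          -- The new element is `w` itself, which does not reach `v`.
          w , ∈-subset⁺ (N⁻? w) (w∈p , inj₁ refl) , λ w∈ → ¬r (inj₁ (proj₂ (∈-subset⁻ (N⁻? v) w∈)))

-- The arithmetic of the bound.

≤-both⇒3q≤2n : ∀ {q k i n} → q ≤ k → q ≤ i → k + i ≡ n → 3 * q ≤ 2 * n
≤-both⇒3q≤2n {q} {k} {i} q≤k q≤i refl = begin
  3 * q       ≤⟨ *-monoˡ-≤ q (n≤1+n 3) ⟩
  4 * q       ≡⟨ solve 1 (λ q → con 4 :* q := con 2 :* (q :+ q)) refl q ⟩
  2 * (q + q) ≤⟨ *-monoʳ-≤ 2 (+-mono-≤ q≤k q≤i) ⟩
  2 * (k + i) ∎
  where
  open ≤-Reasoning
  open +-*-Solver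

-- The weighted sum `q₂ + 2 * q₁` is at most `3 + k₁ + 2 * i`, because the `2 * h` bounding `c`
-- joins `2 * s` to stay below `2 * i`. Of the 3, one unit is absorbed by `k₁ < k` and two by
-- `2 ≤ k`, which leaves `2 * n`. So `q₁` and `q₂` cannot both exceed two thirds of `n`.
3q₁≤2n⊎3q₂≤2n : ∀ {q₁ q₂ s h c k₁ k i n} → q₁ ≤ 1 + s → s + h ≤ i → c ≤ h + h → q₂ ≤ 1 + (k₁ + c) →
                k₁ < k → 2 ≤ k → k + i ≡ n → 3 * q₁ ≤ 2 * n ⊎ 3 * q₂ ≤ 2 * n
3q₁≤2n⊎3q₂≤2n {q₁} {q₂} {s} {h} {c} {k₁} {k} {i} {n} q₁≤ s+h≤i c≤ q₂≤ k₁<k 2≤k refl with 3 * q₁ ≤? 2 * n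
... | yes 3q₁≤2n = inj₁ 3q₁≤2n
... | no  3q₁≰2n = inj₂ (
  +-cancelʳ-≤ (2 * (2 * n)) (3 * q₂) (2 * n) (begin
    3 * q₂ + 2 * (2 * n)                              ≤⟨ +-monoʳ-≤ (3 * q₂) (*-monoʳ-≤ 2 (≰⇒≥ 3q₁≰2n)) ⟩
    3 * q₂ + 2 * (3 * q₁)                             ≤⟨ +-mono-≤ (*-monoʳ-≤ 3 q₂≤) (*-monoʳ-≤ 2 (*-monoʳ-≤ 3 q₁≤)) ⟩
    3 * (1 + (k₁ + c)) + 2 * (3 * (1 + s))            ≤⟨ +-monoˡ-≤ _ (*-monoʳ-≤ 3 (+-monoʳ-≤ 1 (+-monoʳ-≤ k₁ c≤))) ⟩
    3 * (1 + (k₁ + (h + h))) + 2 * (3 * (1 + s))      ≡⟨ solve 3 (λ k₁ h s →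
        con 3 :* (con 1 :+ (k₁ :+ (h :+ h))) :+ con 2 :* (con 3 :* (con 1 :+ s)) :=
        con 3 :* ((con 1 :+ k₁) :+ con 2) :+ con 6 :* (s :+ h)) refl k₁ h s ⟩
    3 * (suc k₁ + 2) + 6 * (s + h)                    ≤⟨ +-mono-≤ (*-monoʳ-≤ 3 (+-mono-≤ k₁<k 2≤k)) (*-monoʳ-≤ 6 s+h≤i) ⟩
    3 * (k + k) + 6 * i                               ≡⟨ solve 2 (λ k i → con 3 :* (k :+ k) :+ con 6 :* i :=
        con 2 :* (k :+ i) :+ con 2 :* (con 2 :* (k :+ i))) refl k i ⟩
    2 * (k + i) + 2 * (2 * (k + i))                   ∎))
  where
  open ≤-Reasoning
  open +-*-Solver

-- The pieces of a split digraph.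

module Split (D : Digraph n) (sinkFree : SinkFree D) (K I : Subset n) (K∪I≡⊤ : K ∪ I ≡ ⊤) (K∩I≡⊥ : K ∩ I ≡ ⊥)
             (clique : IsClique (underlying D) K) (indep : IsIndependentSet (underlying D) I) where
  open Digraph D

  K⊎I : ∀ u → u ∈ K ⊎ u ∈ I
  K⊎I u = x∈p∪q⁻ K I (subst (u ∈_) (sym K∪I≡⊤) ∈⊤)

  ∣K∣+∣I∣≡n : ∣ K ∣ + ∣ I ∣ ≡ n
  ∣K∣+∣I∣≡n = trans (sym (disjoint⇒∣p∪q∣≡∣p∣+∣q∣ K I K∩I≡⊥)) (trans (cong ∣_∣ K∪I≡⊤) (∣⊤∣≡n n))

  abstract
    hasOut : ∀ u → ∃[ v ] u ⟶ v
    hasOut u = decidable-stable (any? (u ⟶?_)) (λ sink → sinkFree (u , sink))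

  out : Fin n → Fin n
  out u = proj₁ (hasOut u)

  out-arc : ∀ u → u ⟶ out u
  out-arc u = proj₂ (hasOut u)

  out∈K : ∀ {u} → u ∈ I → out u ∈ K
  out∈K {u} u∈I with K⊎I (out u)
  ... | inj₁ ∈K = ∈K
  ... | inj₂ ∈I = contradiction (inj₁ (out-arc u)) (indep u∈I ∈I)

  abstract
    exit? : Decidable (λ x → ∃[ z ] z ∈ I × x ⟶ z)
    exit? x = any? (λ z → (z ∈? I) ×-dec (x ⟶? z))

    ∈K₁? : Decidable (λ x → x ∈ K × ∃[ z ] z ∈ I × x ⟶ z)
    ∈K₁? x = (x ∈? K) ×-dec exit? x

    ∈K₀? : Decidable (λ x → x ∈ K × ¬ (∃[ z ] z ∈ I × x ⟶ z))
    ∈K₀? x = (x ∈? K) ×-dec ¬? (exit? x)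

  K₀ K₁ : Subset n
  K₀ = subset ∈K₀?
  K₁ = subset ∈K₁?

  K₀⊆K : K₀ ⊆ K
  K₀⊆K = proj₁ ∘ ∈-subset⁻ ∈K₀?

  K₁⊆K : K₁ ⊆ K
  K₁⊆K = proj₁ ∘ ∈-subset⁻ ∈K₁?

  K₀-no-exit : ∀ {x z} → x ∈ K₀ → z ∈ I → ¬ (x ⟶ z)
  K₀-no-exit x∈K₀ z∈I x→z = proj₂ (∈-subset⁻ ∈K₀? x∈K₀) (_ , z∈I , x→z)

  K⇒K₀⊎K₁ : ∀ {x} → x ∈ K → x ∈ K₀ ⊎ x ∈ K₁
  K⇒K₀⊎K₁ {x} x∈K with exit? x
  ... | yes e = inj₂ (∈-subset⁺ ∈K₁? (x∈K , e))
  ... | no ¬e = inj₁ (∈-subset⁺ ∈K₀? (x∈K , ¬e))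

  exitTarget : Fin n → Fin n
  exitTarget x with exit? x
  ... | yes (z , _) = z
  -- A default value; `exitTarget` is applied only to vertices of `K₁`.
  ... | no  _       = x

  exitTarget-spec : ∀ {x} → x ∈ K₁ → exitTarget x ∈ I × x ⟶ exitTarget x
  exitTarget-spec {x} x∈K₁ with exit? x
  ... | yes (_ , spec) = spec
  ... | no  ¬e         = contradiction (proj₂ (∈-subset⁻ ∈K₁? x∈K₁)) ¬e

  J : Subset n
  J = image exitTarget K₁

  J⊆I : J ⊆ I
  J⊆I y∈J with ∈-image⁻ exitTarget K₁ y∈J
  ... | x , x∈K₁ , refl = proj₁ (exitTarget-spec x∈K₁)

  abstract
    intoK₁? : Decidable (λ u → ∃[ x ] x ∈ K₁ × u ⟶ x)
    intoK₁? u = any? (λ x → (x ∈? K₁) ×-dec (u ⟶? x))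

    ∈C? : Decidable (λ y → y ∈ I × y ∉ J × ¬ (∃[ x ] x ∈ K₁ × y ⟶ x))
    ∈C? y = (y ∈? I) ×-dec (¬? (y ∈? J) ×-dec ¬? (intoK₁? y))

  C : Subset n
  C = subset ∈C?

  C⊆I : C ⊆ I
  C⊆I = proj₁ ∘ ∈-subset⁻ ∈C?

  -- An outneighbour of a vertex of `I` lies in `K`, and the definition of `C` rules out `K₁`.
  out-C∈K₀ : ∀ {y} → y ∈ C → out y ∈ K₀
  out-C∈K₀ {y} y∈C with ∈-subset⁻ ∈C? y∈C
  ... | y∈I , _ , ¬into = [ (λ ∈K₀ → ∈K₀) , (λ ∈K₁ → contradiction (out y , ∈K₁ , out-arc y) ¬into) ]′
                            (K⇒K₀⊎K₁ (out∈K y∈I))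

  J∪C⊆I : J ∪ C ⊆ I
  J∪C⊆I = [ J⊆I , C⊆I ]′ ∘ x∈p∪q⁻ J C

  ∣J∪C∣≤∣K₁∣+∣C∣ : ∣ J ∪ C ∣ ≤ ∣ K₁ ∣ + ∣ C ∣
  ∣J∪C∣≤∣K₁∣+∣C∣ = ≤-trans (∣p∪q∣≤∣p∣+∣q∣ J C) (+-monoˡ-≤ ∣ C ∣ (∣image∣≤ exitTarget K₁))

  I⇒J∪C⊎intoK₁ : ∀ {y} → y ∈ I → y ∈ J ∪ C ⊎ ∃[ x ] x ∈ K₁ × y ⟶ x
  I⇒J∪C⊎intoK₁ {y} y∈I with y ∈? J | intoK₁? y
  ... | yes y∈J | _        = inj₁ (x∈p∪q⁺ (inj₁ y∈J))
  ... | no  _   | yes into = inj₂ into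
  ... | no  y∉J | no ¬into = inj₁ (x∈p∪q⁺ (inj₂ (∈-subset⁺ ∈C? (y∈I , y∉J , ¬into))))

  -- A vertex of `K₁` reaches `J` in one step, so a vertex with an arc into `K₁` does so in two. The
  -- remaining vertices belong to `J ∪ C`.
  J∪C-quasiKernel : (∀ {u} → u ∈ K₀ → ∃[ x ] x ∈ K₁ × u ⟶ x) → IsQuasiKernel D (J ∪ C)
  J∪C-quasiKernel K₀-into = absorbing⇒quasiKernel D
    (λ u∈ v∈ u→v → indep (J∪C⊆I u∈) (J∪C⊆I v∈) (inj₁ u→v)) absorbs
    where
    target∈ : ∀ {x} → x ∈ K₁ → exitTarget x ∈ J ∪ C
    target∈ x∈K₁ = x∈p∪q⁺ (inj₁ (∈-image⁺ exitTarget K₁ x∈K₁))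

    via : ∀ {u} → ∃[ x ] x ∈ K₁ × u ⟶ x → ∃[ v ] v ∈ J ∪ C × Reach₂ D u v
    via (x , x∈K₁ , u→x) = exitTarget x , target∈ x∈K₁ , inj₂ (x , u→x , proj₂ (exitTarget-spec x∈K₁))

    absorbs : ∀ u → ∃[ v ] v ∈ J ∪ C × Reach₂ D u v
    absorbs u with K⊎I u
    ... | inj₂ u∈I = [ (λ u∈ → u , u∈ , inj₁ (inj₁ refl)) , via ]′ (I⇒J∪C⊎intoK₁ u∈I)
    ... | inj₁ u∈K = [ via ∘ K₀-into
                     , (λ u∈K₁ → exitTarget u , target∈ u∈K₁ , inj₁ (inj₂ (proj₂ (exitTarget-spec u∈K₁)))) ]′
                     (K⇒K₀⊎K₁ u∈K)

  -- The sets `v * S` centred at a vertex of `K₀`.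

  module Centred (v : Fin n) (S : Subset n) (v∈K₀ : v ∈ K₀) (S⊆I : S ⊆ I) where

    abstract
      ∈S∖N⁻? : Decidable (λ y → y ∈ S × ¬ (y ⟶ v))
      ∈S∖N⁻? y = (y ∈? S) ×-dec ¬? (y ⟶? v)

    Q : Subset n
    Q = ⁅ v ⁆ ∪ subset ∈S∖N⁻?

    v∈Q : v ∈ Q
    v∈Q = x∈p∪q⁺ (inj₁ (x∈⁅x⁆ v))

    ∣Q∣≤1+∣S∣ : ∣ Q ∣ ≤ 1 + ∣ S ∣
    ∣Q∣≤1+∣S∣ = ≤-trans (∣p∪q∣≤∣p∣+∣q∣ ⁅ v ⁆ _)
      (+-mono-≤ (≤-reflexive (∣⁅x⁆∣≡1 v)) (p⊆q⇒∣p∣≤∣q∣ (proj₁ ∘ ∈-subset⁻ ∈S∖N⁻?)))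

    ∈Q⁻ : ∀ {u} → u ∈ Q → u ≡ v ⊎ (u ∈ I × ¬ (u ⟶ v))
    ∈Q⁻ u∈Q with x∈p∪q⁻ ⁅ v ⁆ _ u∈Q
    ... | inj₁ u∈⁅v⁆ = inj₁ (x∈⁅y⁆⇒x≡y v u∈⁅v⁆)
    ... | inj₂ u∈    = let (u∈S , ¬u→v) = ∈-subset⁻ ∈S∖N⁻? u∈ in inj₂ (S⊆I u∈S , ¬u→v)

    independent : IsIndependent D Q
    independent a∈Q b∈Q a→b with ∈Q⁻ a∈Q | ∈Q⁻ b∈Q
    ... | inj₁ refl       | inj₁ refl       = irrefl refl a→b
    ... | inj₁ refl       | inj₂ (b∈I , _)  = K₀-no-exit v∈K₀ b∈I a→b
    ... | inj₂ (_ , ¬a→v) | inj₁ refl       = ¬a→v a→b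
    ... | inj₂ (a∈I , _)  | inj₂ (b∈I , _)  = indep a∈I b∈I (inj₁ a→b)

    S-reach₁ : ∀ {y} → y ∈ S → ∃[ w ] w ∈ Q × Reach₁ D y w
    S-reach₁ {y} y∈S with y ⟶? v
    ... | yes y→v = v , v∈Q , inj₂ y→v
    ... | no ¬y→v = y , x∈p∪q⁺ (inj₂ (∈-subset⁺ ∈S∖N⁻? (y∈S , ¬y→v))) , inj₁ refl

    -- The vertices removed from `S` are those with an arc to `v`, so every vertex of `S` is still
    -- within one step of `Q`. An arc into `S` therefore leads to `Q` within two steps.
    quasiKernel : (∀ u → Reach₂ D u v ⊎ u ∈ S ⊎ ∃[ y ] y ∈ S × u ⟶ y) → IsQuasiKernel D Q
    quasiKernel covers = absorbing⇒quasiKernel D independent absorbs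
      where
      absorbs : ∀ u → ∃[ w ] w ∈ Q × Reach₂ D u w
      absorbs u with covers u
      ... | inj₁ r                        = v , v∈Q , r
      ... | inj₂ (inj₁ u∈S)               = let (w , w∈Q , r) = S-reach₁ u∈S in w , w∈Q , inj₁ r
      ... | inj₂ (inj₂ (y , y∈S , u→y))   = let (w , w∈Q , r) = S-reach₁ y∈S in w , w∈Q , arc-reach₁ D u→y r

  -- The first quasi-kernel, by averaging over `C`.

  subclique : ∀ {p} → p ⊆ K → IsClique (underlying D) p
  subclique p⊆K u∈p v∈p = clique (p⊆K u∈p) (p⊆K v∈p)

  abstract
    ∈half? : ∀ v → Decidable (λ y → y ∈ C × Reach₁ D (out y) v)
    ∈half? v y = (y ∈? C) ×-dec reach₁? D (out y) v

  -- Testing only the fixed outneighbour `out y` suffices for a path of length at most two from `y`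
  -- to `v`. Whether this captures half of `C` depends on `v`.
  half : Fin n → Subset n
  half v = subset (∈half? v)

  abstract
    T? : Decidable₂ (λ x y → x ∈ C × y ∈ C × Reach₁ D (out x) (out y))
    T? x y = (x ∈? C) ×-dec ((y ∈? C) ×-dec reach₁? D (out x) (out y))

  -- The outneighbours `out y` lie in the clique, so any two vertices of `C` are comparable under
  -- the relation of `T?`. Hence `C` is covered by the successors and predecessors of each `y`. For
  -- a `y` with at least as many predecessors as successors, the predecessors make up half of `C`,
  -- and they lie in `half (out y)`.
  ∃∣C∣≤2∣half∣ : Nonempty K₀ → ∃[ v ] v ∈ K₀ × ∣ C ∣ ≤ ∣ half v ∣ + ∣ half v ∣
  ∃∣C∣≤2∣half∣ (v₀ , v₀∈K₀) with nonempty? C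
  ... | no  empty    = v₀ , v₀∈K₀ , ≤-trans
        (p⊆q⇒∣p∣≤∣q∣ {q = half v₀} (λ y∈C → contradiction (_ , y∈C) empty)) (m≤m+n _ _)
  ... | yes nonempty with ∃∣successors∣≤∣predecessors∣ T? (proj₁ ∘ proj₂) nonempty
  ... | y , y∈C , succ≤pred = out y , out-C∈K₀ y∈C , (begin
    ∣ C ∣                                       ≤⟨ p⊆q⇒∣p∣≤∣q∣ comparable ⟩
    ∣ successors T? y ∪ predecessors T? y ∣     ≤⟨ ∣p∪q∣≤∣p∣+∣q∣ (successors T? y) _ ⟩
    ∣ successors T? y ∣ + ∣ predecessors T? y ∣ ≤⟨ +-monoˡ-≤ _ succ≤pred ⟩
    ∣ predecessors T? y ∣ + ∣ predecessors T? y ∣ ≤⟨ +-mono-≤ pred≤half pred≤half ⟩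
    ∣ half (out y) ∣ + ∣ half (out y) ∣         ∎)
    where
    open ≤-Reasoning
    pred≤half : ∣ predecessors T? y ∣ ≤ ∣ half (out y) ∣
    pred≤half = p⊆q⇒∣p∣≤∣q∣ λ z∈ →
      let (z∈C , _ , r) = ∈-subset⁻ (λ x → T? x y) z∈ in ∈-subset⁺ (∈half? (out y)) (z∈C , r)

    comparable : C ⊆ successors T? y ∪ predecessors T? y
    comparable {z} z∈C with out z ≟ out y
    ... | yes eq = x∈p∪q⁺ (inj₂ (∈-subset⁺ (λ x → T? x y) (z∈C , y∈C , inj₁ eq)))
    ... | no neq with clique (out∈K (C⊆I z∈C)) (out∈K (C⊆I y∈C)) neq
    ... | inj₁ z→y = x∈p∪q⁺ (inj₂ (∈-subset⁺ (λ x → T? x y) (z∈C , y∈C , inj₂ z→y)))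
    ... | inj₂ y→z = x∈p∪q⁺ (inj₁ (∈-subset⁺ (T? y) (y∈C , z∈C , inj₂ y→z)))

  -- The king `v` is reached from `K₀` and, through `out`, from `half v`. Since `C` avoids `J`,
  -- removing `half v` from `I` keeps `J`, so each vertex of `K₁` still has an arc into `S`. The
  -- numbers `s` and `h` are the sizes of `S` and `half v`.
  Q₁-exists : Nonempty K₀ → ∃[ Q ] IsQuasiKernel D Q ×
    ∃[ s ] ∃[ h ] ∣ Q ∣ ≤ 1 + s × s + h ≤ ∣ I ∣ × ∣ C ∣ ≤ h + h
  Q₁-exists K₀≠∅ with ∃∣C∣≤2∣half∣ K₀≠∅
  ... | v₀ , v₀∈K₀ , C≤ with ∃king D (subclique K₀⊆K) v₀∈K₀
  ... | v , (v∈K₀ , king) , N⁻v₀⊆N⁻v = Q , quasiKernel covers , ∣ S ∣ , ∣ half v ∣ , ∣Q∣≤1+∣S∣ ,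
      q⊆p⇒∣p∩∁q∣+∣q∣≤∣p∣ I (half v) (C⊆I ∘ proj₁ ∘ ∈-subset⁻ (∈half? v)) ,
      ≤-trans C≤ (+-mono-≤ half-mono half-mono)
    where
    S : Subset n
    S = I ∩ ∁ (half v)

    half-mono : ∣ half v₀ ∣ ≤ ∣ half v ∣
    half-mono = p⊆q⇒∣p∣≤∣q∣ λ y∈ → let (y∈C , r) = ∈-subset⁻ (∈half? v₀) y∈ in
      ∈-subset⁺ (∈half? v) (y∈C , N⁻v₀⊆N⁻v (out-C∈K₀ y∈C) r)

    open Centred v S v∈K₀ (p∩q⊆p I _)

    J⊆S : J ⊆ S
    J⊆S y∈J = x∈p∩q⁺ (J⊆I y∈J , x∉p⇒x∈∁p λ y∈half →
      proj₁ (proj₂ (∈-subset⁻ ∈C? (proj₁ (∈-subset⁻ (∈half? v) y∈half)))) y∈J)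

    covers : ∀ u → Reach₂ D u v ⊎ u ∈ S ⊎ ∃[ y ] y ∈ S × u ⟶ y
    covers u with K⊎I u
    ... | inj₁ u∈K = [ inj₁ ∘ king , (λ u∈K₁ → inj₂ (inj₂ (exitTarget u ,
                         J⊆S (∈-image⁺ exitTarget K₁ u∈K₁) , proj₂ (exitTarget-spec u∈K₁)))) ]′ (K⇒K₀⊎K₁ u∈K)
    ... | inj₂ u∈I with u ∈? half v
    ... | yes u∈half = inj₁ (arc-reach₁ D (out-arc u) (proj₂ (∈-subset⁻ (∈half? v) u∈half)))
    ... | no  u∉half = inj₂ (inj₁ (x∈p∩q⁺ (u∈I , x∉p⇒x∈∁p u∉half)))

  -- The second quasi-kernel.

  abstract
    ∈W? : Decidable (λ w → w ∈ K₀ × ¬ (∃[ x ] x ∈ K₁ × w ⟶ x))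
    ∈W? w = (w ∈? K₀) ×-dec ¬? (intoK₁? w)

  Q₂-exists : ∃[ Q ] IsQuasiKernel D Q × ∣ Q ∣ ≤ 1 + (∣ K₁ ∣ + ∣ C ∣)
  Q₂-exists with any? ∈W?
  ... | no  W=∅ = J ∪ C ,
        J∪C-quasiKernel (λ {u} u∈K₀ → decidable-stable (intoK₁? u) (λ ¬into → W=∅ (u , u∈K₀ , ¬into))) ,
        -- The summand 1 of the bound pays for the centre `w` in the other case.
        m≤n⇒m≤1+n ∣J∪C∣≤∣K₁∣+∣C∣
  ... | yes (w₀ , w₀∈W) with ∃king D (subclique (K₀⊆K ∘ proj₁ ∘ ∈-subset⁻ ∈W?)) (∈-subset⁺ ∈W? w₀∈W)
  ... | w , (w∈W , king) , _ = Q , quasiKernel covers , ≤-trans ∣Q∣≤1+∣S∣ (s≤s ∣J∪C∣≤∣K₁∣+∣C∣)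
    where
    w∈K₀ : w ∈ K₀
    w∈K₀ = proj₁ (∈-subset⁻ ∈W? w∈W)

    open Centred w (J ∪ C) w∈K₀ J∪C⊆I

    -- Vertices of `K₁` are adjacent to `w` in the clique, and `w` sends no arc into `K₁`. So
    -- whatever has an arc into `K₁` reaches `w` in two steps.
    K₁⟶w : ∀ {x} → x ∈ K₁ → x ⟶ w
    K₁⟶w {x} x∈K₁ with clique (K₁⊆K x∈K₁) (K₀⊆K w∈K₀)
                         (λ { refl → proj₂ (∈-subset⁻ ∈K₀? w∈K₀) (proj₂ (∈-subset⁻ ∈K₁? x∈K₁)) })
    ... | inj₁ x→w = x→w
    ... | inj₂ w→x = contradiction (x , x∈K₁ , w→x) (proj₂ (∈-subset⁻ ∈W? w∈W))

    via : ∀ {u} → ∃[ x ] x ∈ K₁ × u ⟶ x → Reach₂ D u w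
    via (x , x∈K₁ , u→x) = inj₂ (x , u→x , K₁⟶w x∈K₁)

    covers : ∀ u → Reach₂ D u w ⊎ u ∈ J ∪ C ⊎ ∃[ y ] y ∈ J ∪ C × u ⟶ y
    covers u with K⊎I u
    ... | inj₂ u∈I = [ inj₂ ∘ inj₁ , inj₁ ∘ via ]′ (I⇒J∪C⊎intoK₁ u∈I)
    ... | inj₁ u∈K with K⇒K₀⊎K₁ u∈K | intoK₁? u
    ... | inj₂ u∈K₁ | _        = inj₁ (inj₁ (inj₂ (K₁⟶w u∈K₁)))
    ... | inj₁ _    | yes into = inj₁ (via into)
    -- Such a vertex belongs to the set of which `w` is a king.
    ... | inj₁ u∈K₀ | no ¬into = inj₁ (king (∈-subset⁺ ∈W? (u∈K₀ , ¬into)))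

  -- Combining the bounds.

  K₀-nonempty⇒∣K₁∣<∣K∣ : Nonempty K₀ → ∣ K₁ ∣ < ∣ K ∣
  K₀-nonempty⇒∣K₁∣<∣K∣ (v , v∈K₀) = p⊂q⇒∣p∣<∣q∣ (K₁⊆K , v , K₀⊆K v∈K₀ ,
    λ v∈K₁ → proj₂ (∈-subset⁻ ∈K₀? v∈K₀) (proj₂ (∈-subset⁻ ∈K₁? v∈K₁)))

  -- As `v` is not a sink and has no outneighbour in `I`, its outneighbour is a second vertex of
  -- `K`.
  K₀-nonempty⇒2≤∣K∣ : Nonempty K₀ → 2 ≤ ∣ K ∣
  K₀-nonempty⇒2≤∣K∣ (v , v∈K₀) = ≤-trans
    (s≤s (≤-trans (s≤s z≤n) (x∈p⇒∣p-x∣<∣p∣ (x∈p∧x≢y⇒x∈p-y out∈ (⟶⇒≢ D (out-arc v) ∘ sym)))))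
    (x∈p⇒∣p-x∣<∣p∣ (K₀⊆K v∈K₀))
    where
    out∈ : out v ∈ K
    out∈ = [ (λ ∈K → ∈K) , (λ ∈I → contradiction (out-arc v) (K₀-no-exit v∈K₀ ∈I)) ]′ (K⊎I (out v))

  smallQuasiKernel : ∃[ Q ] IsQuasiKernel D Q × 3 * ∣ Q ∣ ≤ 2 * n
  smallQuasiKernel with nonempty? K₀
  ... | no K₀=∅ = J ∪ C , J∪C-quasiKernel (λ u∈K₀ → contradiction (_ , u∈K₀) K₀=∅) ,
      ≤-both⇒3q≤2n ∣J∪C∣≤∣K∣ (p⊆q⇒∣p∣≤∣q∣ J∪C⊆I) ∣K∣+∣I∣≡n
    where
    -- Without `K₀` the set `C` is empty, because `out` maps `C` into `K₀`.
    J∪C⊆J : J ∪ C ⊆ J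
    J∪C⊆J = [ (λ y∈J → y∈J) , (λ y∈C → contradiction (_ , out-C∈K₀ y∈C) K₀=∅) ]′ ∘ x∈p∪q⁻ J C
    ∣J∪C∣≤∣K∣ : ∣ J ∪ C ∣ ≤ ∣ K ∣
    ∣J∪C∣≤∣K∣ = ≤-trans (p⊆q⇒∣p∣≤∣q∣ J∪C⊆J) (≤-trans (∣image∣≤ exitTarget K₁) (p⊆q⇒∣p∣≤∣q∣ K₁⊆K))
  ... | yes K₀≠∅ =
    let (Q₁ , qk₁ , s , h , q₁≤ , s+h≤ , C≤) = Q₁-exists K₀≠∅
        (Q₂ , qk₂ , q₂≤) = Q₂-exists
    in [ (λ small → Q₁ , qk₁ , small) , (λ small → Q₂ , qk₂ , small) ]′
         (3q₁≤2n⊎3q₂≤2n q₁≤ s+h≤ C≤ q₂≤ (K₀-nonempty⇒∣K₁∣<∣K∣ K₀≠∅) (K₀-nonempty⇒2≤∣K∣ K₀≠∅) ∣K∣+∣I∣≡n)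

theorem1p1 : ∀ (n : ℕ) (D : Digraph n) → SinkFree D → IsSplitDigraph D →
    ∃[ Q ] IsQuasiKernel D Q × (3 * ∣ Q ∣ ≤ 2 * n)
theorem1p1 n D sinkFree (K , I , K∪I≡⊤ , K∩I≡⊥ , clique , indep) =
  Split.smallQuasiKernel D sinkFree K I K∪I≡⊤ K∩I≡⊥ clique indep
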